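{- For every prime $p\ge 3$, $$r_p(\mathbb{F}_p^3)\ge p^3-3p^2+\frac18p^{3/2}-\frac{7}{16}p.$$ As a consequence, $r_p(\mathbb{F}_p^3)\ge (p-1)^3+\frac18p^{3/2}-O(p)$ as the prime $p$ tends to infinity.
   Context: $\mathbb{F}_p$ denotes the field with $p$ elements and $\mathbb{F}_p^n$ the $n$-dimensional vector space over it. For integers $k$ and $n$, $r_k(\mathbb{F}_p^n)$ denotes the largest size of a subset $S\subseteq\mathbb{F}_p^n$ containing no nontrivial $k$-term arithmetic progression, i.e. no set $\{\mathbf{a},\mathbf{a}+\mathbf{v},\ldots,\mathbf{a}+(k-1)\mathbf{v}\}$ with $\mathbf{v}\neq\mathbf{0}$. For $k=p$ this is equivalent to $S$ containing no full affine line $\{\mathbf{a}+\lambda\mathbf{v}:\lambda\in\mathbb{F}_p\}$ with $\mathbf{v}\ne\mathbf{0}$. -}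

module Defs where

open import Data.Nat using (ℕ; NonZero; _+_; _*_)
open import Data.Nat.DivMod using (_mod_)
open import Data.Fin using (Fin; toℕ)
open import Data.List using (List; length)
open import Data.List.Membership.Propositional using (_∈_)
open import Data.List.Relation.Unary.Unique.Propositional using (Unique)
open import Data.Product using (Σ; ∃; _×_)
open import Relation.Binary.PropositionalEquality using (_≡_)
open import Relation.Nullary using (¬_)

-- The field F_p, represented as Fin p with arithmetic mod p.
-- (p is a prime in the theorem; the operations only need p ≠ 0.)
F : ℕ → Set
F p = Fin p

addF : (p : ℕ) .{{_ : NonZero p}} → F p → F p → F p
addF p a b = (toℕ a + toℕ b) mod p

nmulF : (p : ℕ) .{{_ : NonZero p}} → ℕ → F p → F p
nmulF p i a = (i * toℕ a) mod p

Vect : ℕ → ℕ → Set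
Vect p n = Fin n → F p

zeroV : (p n : ℕ) .{{_ : NonZero p}} → Vect p n
zeroV p n _ = 0 mod p

apPoint : (p n : ℕ) .{{_ : NonZero p}} → Vect p n → ℕ → Vect p n → Vect p n
apPoint p n a i v j = addF p (a j) (nmulF p i (v j))

ContainsAP : (k p n : ℕ) .{{_ : NonZero p}} → List (Vect p n) → Set
ContainsAP k p n S =
  Σ (Vect p n) λ a → Σ (Vect p n) λ v →
    (¬ (∀ j → v j ≡ zeroV p n j)) × ((i : Fin k) → apPoint p n a (toℕ i) v ∈ S)

APFree : (k p n : ℕ) .{{_ : NonZero p}} → List (Vect p n) → Set
APFree k p n S = Unique S × ¬ ContainsAP k p n S

module Submission where

-- The complement is a set meeting every line. The coordinate planes form one, with
-- 3p² - 3p + 1 points. Let b run over r ≈ √p/2 nonzero values and replace, in each plane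
-- y = b, the line z = 0 by z = bx, keeping the r² points (1/c, b, 0) so that the planes
-- x = 1/c still contain their line z = 0. Then (0, b, t) with t odd and (1/b, 0, t + 1)
-- may be dropped (representatives in [1, p - 1]) at the price of one point (1/b, b, t + 1):
-- it lies both on the parallel to z = bx through the former and on the line with fixed
-- x and z through the latter. This gains about rp/2 points. The only lines now missed
-- join some (0, b, t) to some (1/c, 0, u) and cross z = 0 in a removed line y = b′, at
-- x = (b - b′)/(bc): at most r³ points, which are put back. The net gain is
-- p^(3/2)/4 - p^(3/2)/8 up to O(p).

open import Defs
open import Data.Nat using (ℕ; NonZero; _+_; _*_; _∸_; _^_; _≤_)
open import Data.Nat.Primality using (Prime; prime⇒irreducible; prime⇒nonTrivial)
open import Data.List using (List; length; map; filter; allFin; cartesianProduct; lookup; _++_)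
open import Data.Product using (Σ; _×_; _,_; ∃; ∃₂; proj₁; proj₂)

import Data.Nat as ℕ
import Data.Nat.Properties as ℕ
import Data.Nat.Divisibility as ℕ
import Data.Nat.Tactic.RingSolver as ℕ-Solver
open import Data.Nat.Coprimality using (prime⇒coprime; coprime-Bézout)
open import Data.Nat.GCD using (module Bézout)
open import Data.Nat.DivMod using (_%_; _/_; _mod_; m%n<n; m≡m%n+[m/n]*n)
open import Data.Integer as ℤ using (ℤ; +_; 0ℤ; 1ℤ)
import Data.Integer.Properties as ℤ
import Data.Integer.DivMod as ℤ
open import Data.Integer.Divisibility.Signed as ℤ using (divides; ∣⇒∣ᵤ; ∣m∣n⇒∣m+n; ∣m⇒∣-m; ∣n⇒∣m*n)
open import Data.Integer.Tactic.RingSolver using (solve-∀)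
open import Data.Fin as Fin using (Fin; toℕ; zero; suc; punchIn)
import Data.Fin.Properties as Fin
import Data.Vec.Functional as Vector
open import Data.List.Properties using (length-map; length-++; length-tabulate)
open import Data.List.Membership.Propositional using (_∈_; _∉_)
open import Data.List.Membership.Propositional.Properties
import Data.List.Membership.Setoid.Properties as Membershipₛ
open import Data.List.Relation.Binary.Subset.Propositional using (_⊆_)
open import Data.List.Relation.Unary.Any using (index)
open import Data.List.Relation.Unary.All using () renaming (lookup to All-lookup)
open import Data.List.Relation.Unary.AllPairs using (_∷_)
open import Data.List.Relation.Unary.Unique.Propositional using (Unique)
import Data.List.Relation.Unary.Unique.Propositional.Properties as Unique
import Data.Product.Properties as Product
open import Data.Sum using (inj₁; inj₂; _⊎_)
open import Data.Bool using (if_then_else_)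
open import Function using (_∘_; _∋_)
open import Level using (0ℓ)
open import Relation.Binary using (Setoid; DecidableEquality)
open import Relation.Binary.PropositionalEquality
open import Relation.Nullary using (¬_; Dec; yes; no; contradiction; ¬?; does)
import Relation.Nullary.Decidable as Dec
import Relation.Binary.Reasoning.Setoid as SetoidReasoning

-- Counting in lists

module _ {a} {A : Set a} where

  lookup-injective : ∀ {xs : List A} → Unique xs → ∀ {i j} → lookup xs i ≡ lookup xs j → i ≡ j
  lookup-injective (_ ∷ _)   {zero}  {zero}  _  = refl
  lookup-injective (x∉ ∷ _)  {zero}  {suc j} eq = contradiction eq (All-lookup x∉ (∈-lookup j))
  lookup-injective (x∉ ∷ _)  {suc i} {zero}  eq = contradiction (sym eq) (All-lookup x∉ (∈-lookup i))
  lookup-injective (_ ∷ u)   {suc i} {suc j} eq = cong suc (lookup-injective u eq)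

  -- Sending each position in `xs` to a position of the same element in `ys` is injective. The list
  -- `ys` may repeat elements, as `exceptional` below may.
  length-mono-⊆ : ∀ {xs ys : List A} → Unique xs → xs ⊆ ys → length xs ≤ length ys
  length-mono-⊆ {xs} u xs⊆ys = Fin.injective⇒≤ {f = λ i → index (xs⊆ys (∈-lookup {xs = xs} i))}
    λ {i} {j} eq → lookup-injective u
      (Membershipₛ.index-injective (setoid A) (xs⊆ys (∈-lookup i)) (xs⊆ys (∈-lookup j)) eq)

length-allFin : ∀ n → length (allFin n) ≡ n
length-allFin n = length-tabulate {n = n} (λ i → i)

length-cartesianProduct : ∀ {A B : Set} (xs : List A) (ys : List B) →
  length (cartesianProduct xs ys) ≡ length xs * length ys
length-cartesianProduct List.[] ys = refl
length-cartesianProduct (x List.∷ xs) ys = begin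
  length (map (x ,_) ys ++ cartesianProduct xs ys)        ≡⟨ length-++ (map (x ,_) ys) ⟩
  length (map (x ,_) ys) + length (cartesianProduct xs ys) ≡⟨ cong₂ _+_ (length-map _ ys) (length-cartesianProduct xs ys) ⟩
  length ys + length xs * length ys                       ∎
  where open ≡-Reasoning

-- Congruence modulo p = n + 1, representatives and inverses

module Residues (n : ℕ) where

  private
    p = ℕ.suc n
    P = + p

  infix 4 _≈_ _≉_ _≈?_

  -- A record around the divisibility, so that `a` and `b` can be inferred from the type of a
  -- congruence.
  record _≈_ (a b : ℤ) : Set where
    constructor ≈⁺
    field ≈⁻ : P ℤ.∣ a ℤ.- b
  open _≈_

  _≉_ : ℤ → ℤ → Set
  a ≉ b = ¬ a ≈ b

  opaque
    _≈?_ : ∀ a b → Dec (a ≈ b)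
    a ≈? b = Dec.map′ ≈⁺ ≈⁻ (P ℤ.∣? (a ℤ.- b))

  private
    via : ∀ {a b e} → P ℤ.∣ e → a ℤ.- b ≡ e → a ≈ b
    via d eq = ≈⁺ (subst (P ℤ.∣_) (sym eq) d)

  opaque
    ≈-reflexive : ∀ {a b} → a ≡ b → a ≈ b
    ≈-reflexive {a} refl = ≈⁺ (divides 0ℤ (ℤ.+-inverseʳ a))

    ≈-refl : ∀ {a} → a ≈ a
    ≈-refl = ≈-reflexive refl

    ≈-sym : ∀ {a b} → a ≈ b → b ≈ a
    ≈-sym {a} {b} e = via (∣m⇒∣-m (≈⁻ e)) (identity a b)
      where
      identity : ∀ a b → b ℤ.- a ≡ ℤ.- (a ℤ.- b)
      identity = solve-∀

    ≈-trans : ∀ {a b c} → a ≈ b → b ≈ c → a ≈ c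
    ≈-trans {a} {b} {c} e f = via (∣m∣n⇒∣m+n (≈⁻ e) (≈⁻ f)) (identity a b c)
      where
      identity : ∀ a b c → a ℤ.- c ≡ (a ℤ.- b) ℤ.+ (b ℤ.- c)
      identity = solve-∀

    +-cong : ∀ {a b c d} → a ≈ b → c ≈ d → a ℤ.+ c ≈ b ℤ.+ d
    +-cong {a} {b} {c} {d} e f = via (∣m∣n⇒∣m+n (≈⁻ e) (≈⁻ f)) (identity a b c d)
      where
      identity : ∀ a b c d → (a ℤ.+ c) ℤ.- (b ℤ.+ d) ≡ (a ℤ.- b) ℤ.+ (c ℤ.- d)
      identity = solve-∀

    -‿cong : ∀ {a b} → a ≈ b → ℤ.- a ≈ ℤ.- b
    -‿cong {a} {b} e = via (∣m⇒∣-m (≈⁻ e)) (identity a b)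
      where
      identity : ∀ a b → (ℤ.- a) ℤ.- (ℤ.- b) ≡ ℤ.- (a ℤ.- b)
      identity = solve-∀

    *-cong : ∀ {a b c d} → a ≈ b → c ≈ d → a ℤ.* c ≈ b ℤ.* d
    *-cong {a} {b} {c} {d} e f = via (∣m∣n⇒∣m+n (∣n⇒∣m*n c (≈⁻ e)) (∣n⇒∣m*n b (≈⁻ f))) (identity a b c d)
      where
      identity : ∀ a b c d → a ℤ.* c ℤ.- b ℤ.* d ≡ c ℤ.* (a ℤ.- b) ℤ.+ b ℤ.* (c ℤ.- d)
      identity = solve-∀

    minus-cong : ∀ {a b c d} → a ≈ b → c ≈ d → a ℤ.- c ≈ b ℤ.- d
    minus-cong e f = +-cong e (-‿cong f)

  ≈-setoid : Setoid 0ℓ 0ℓ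
  ≈-setoid = record { Carrier = ℤ ; _≈_ = _≈_
    ; isEquivalence = record { refl = ≈-refl ; sym = ≈-sym ; trans = ≈-trans } }

  multiple≈0 : ∀ k → k ℤ.* P ≈ 0ℤ
  multiple≈0 k = ≈⁺ (divides k (ℤ.+-identityʳ _))

  -- The distance is at most the larger of the two numbers, hence below p, and a multiple of p below
  -- p is 0.
  ≈⇒≡ : ∀ {a b} → a ℕ.< p → b ℕ.< p → + a ≈ + b → a ≡ b
  ≈⇒≡ {a} {b} a<p b<p e = ℤ.+-injective (ℤ.i-j≡0⇒i≡j (+ a) (+ b) (ℤ.∣i∣≡0⇒i≡0 distance≡0))
    where
    distance<p : ℤ.∣ + a ℤ.- + b ∣ ℕ.< p
    distance<p = ℕ.≤-<-trans
      (subst (λ z → ℤ.∣ z ∣ ≤ a ℕ.⊔ b) (sym (ℤ.m-n≡m⊖n a b)) (ℤ.∣m⊝n∣≤m⊔n a b))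
      (ℕ.⊔-lub a<p b<p)
    distance≡0 : ℤ.∣ + a ℤ.- + b ∣ ≡ 0
    distance≡0 with ℤ.∣ + a ℤ.- + b ∣ | distance<p | ∣⇒∣ᵤ (≈⁻ e)
    ... | ℕ.zero  | _   | _   = refl
    ... | ℕ.suc _ | d<p | p∣d = contradiction p∣d (ℕ.>⇒∤ d<p)

  ⟦_⟧ : Fin p → ℤ
  ⟦ x ⟧ = + toℕ x

  ⟦⟧-injective : ∀ {x y} → ⟦ x ⟧ ≈ ⟦ y ⟧ → x ≡ y
  ⟦⟧-injective {x} {y} e = Fin.toℕ-injective (≈⇒≡ (Fin.toℕ<n x) (Fin.toℕ<n y) e)

  opaque
    residue : ℤ → Fin p
    residue z = Fin.fromℕ< (ℤ.n%ℕd<d z p)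

    ⟦residue⟧ : ∀ z → ⟦ residue z ⟧ ≈ z
    ⟦residue⟧ z = begin
      + toℕ (residue z)                        ≡⟨ cong +_ (Fin.toℕ-fromℕ< (ℤ.n%ℕd<d z p)) ⟩
      + (z ℤ.%ℕ p)                             ≡⟨ ℤ.+-identityʳ _ ⟨
      + (z ℤ.%ℕ p) ℤ.+ 0ℤ                      ≈⟨ +-cong (≈-refl {+ (z ℤ.%ℕ p)}) (≈-sym (multiple≈0 (z ℤ./ℕ p))) ⟩
      + (z ℤ.%ℕ p) ℤ.+ (z ℤ./ℕ p) ℤ.* P        ≡⟨ ℤ.a≡a%ℕn+[a/ℕn]*n z p ⟨
      z                                        ∎
      where open SetoidReasoning ≈-setoid

  ⟦mod⟧ : ∀ m → ⟦ m mod p ⟧ ≈ + m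
  ⟦mod⟧ m = begin
    + toℕ (m mod p)                          ≡⟨ cong +_ (Fin.toℕ-fromℕ< (m%n<n m p)) ⟩
    + (m % p)                                ≡⟨ ℤ.+-identityʳ _ ⟨
    + (m % p) ℤ.+ 0ℤ                         ≈⟨ +-cong (≈-refl {+ (m % p)}) (multiple≈0 (+ (m / p))) ⟨
    + (m % p) ℤ.+ + (m / p) ℤ.* P            ≡⟨ cong (ℤ._+_ (+ (m % p))) (ℤ.pos-* (m / p) p) ⟨
    + (m % p + m / p * p)                    ≡⟨ cong +_ (m≡m%n+[m/n]*n m p) ⟨
    + m                                      ∎
    where open SetoidReasoning ≈-setoid

  residue-cong : ∀ {z w} → z ≈ w → residue z ≡ residue w
  residue-cong e = ⟦⟧-injective (≈-trans (⟦residue⟧ _) (≈-trans e (≈-sym (⟦residue⟧ _))))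

  residue-injective : ∀ {z w} → residue z ≡ residue w → z ≈ w
  residue-injective {z} {w} e = ≈-trans (≈-sym (⟦residue⟧ z)) (≈-trans (≈-reflexive (cong ⟦_⟧ e)) (⟦residue⟧ w))

  ⟦suc⟧≉0 : ∀ {x : Fin n} → ⟦ suc x ⟧ ≉ 0ℤ
  ⟦suc⟧≉0 {x} e with () ← ⟦⟧-injective {suc x} {zero} e

  module _ (p-prime : Prime p) where

    private
      -- Bézout over the naturals has two signs: 1 + l m = k p gives the inverse - l of m, and 1 + k
      -- p = l m gives l.
      residue-inverse : ∀ x → ⟦ x ⟧ ≉ 0ℤ → ∃ λ u → ⟦ x ⟧ ℤ.* u ≈ 1ℤ
      residue-inverse zero    x≉0 = contradiction ≈-refl x≉0
      residue-inverse (suc x) _ with coprime-Bézout (prime⇒coprime p-prime (Fin.toℕ<n (suc x)))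
      ... | Bézout.+- k l eq = ℤ.- (+ l) , via (∣n⇒∣m*n (ℤ.- (+ k)) ℤ.∣-refl) (begin
          m ℤ.* (ℤ.- (+ l)) ℤ.- 1ℤ             ≡⟨ identity m (+ l) ⟩
          ℤ.- (1ℤ ℤ.+ + l ℤ.* m)                ≡⟨ cong (λ z → ℤ.- (1ℤ ℤ.+ z)) (ℤ.pos-* l (ℕ.suc (toℕ x))) ⟨
          ℤ.- (+ (1 + l * ℕ.suc (toℕ x)))       ≡⟨ cong (λ z → ℤ.- (+ z)) eq ⟩
          ℤ.- (+ (k * p))                       ≡⟨ cong ℤ.-_ (ℤ.pos-* k p) ⟩
          ℤ.- (+ k ℤ.* P)                       ≡⟨ ℤ.neg-distribˡ-* (+ k) P ⟩
          (ℤ.- (+ k)) ℤ.* P                     ∎)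
        where
        open ≡-Reasoning
        m = ⟦ suc x ⟧
        identity : ∀ m l → m ℤ.* (ℤ.- l) ℤ.- 1ℤ ≡ ℤ.- (1ℤ ℤ.+ l ℤ.* m)
        identity = solve-∀
      ... | Bézout.-+ k l eq = + l , via (∣n⇒∣m*n (+ k) ℤ.∣-refl) (begin
          m ℤ.* + l ℤ.- 1ℤ                      ≡⟨ cong (ℤ._- 1ℤ) (ℤ.*-comm m (+ l)) ⟩
          + l ℤ.* m ℤ.- 1ℤ                      ≡⟨ cong (ℤ._- 1ℤ) (ℤ.pos-* l (ℕ.suc (toℕ x))) ⟨
          + (l * ℕ.suc (toℕ x)) ℤ.- 1ℤ          ≡⟨ cong (λ z → + z ℤ.- 1ℤ) eq ⟨
          + (1 + k * p) ℤ.- 1ℤ                  ≡⟨⟩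
          1ℤ ℤ.+ + (k * p) ℤ.- 1ℤ               ≡⟨ cong (λ z → 1ℤ ℤ.+ z ℤ.- 1ℤ) (ℤ.pos-* k p) ⟩
          1ℤ ℤ.+ + k ℤ.* P ℤ.- 1ℤ               ≡⟨ identity (+ k ℤ.* P) ⟩
          + k ℤ.* P                             ∎)
        where
        open ≡-Reasoning
        m = ⟦ suc x ⟧
        identity : ∀ z → 1ℤ ℤ.+ z ℤ.- 1ℤ ≡ z
        identity = solve-∀

    opaque
      inverse : ∀ {z} → z ≉ 0ℤ → ∃ λ u → z ℤ.* u ≈ 1ℤ
      inverse {z} z≉0 =
        let u , eq = residue-inverse (residue z) (z≉0 ∘ ≈-trans (≈-sym (⟦residue⟧ z)))
        in u , ≈-trans (*-cong (≈-sym (⟦residue⟧ z)) ≈-refl) eq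

      -- The parameter is i = (c - a) / v. Hence a line along which a coordinate varies meets every
      -- plane on which that coordinate is fixed.
      affine-solve : ∀ a {v} → v ≉ 0ℤ → ∀ c → ∃ λ i → a ℤ.+ i ℤ.* v ≈ c
      affine-solve a {v} v≉0 c = solution (inverse v≉0)
        where
        identity₁ : ∀ a c u v → a ℤ.+ (c ℤ.- a) ℤ.* u ℤ.* v ≡ a ℤ.+ (c ℤ.- a) ℤ.* (v ℤ.* u)
        identity₁ = solve-∀
        identity₂ : ∀ a c → a ℤ.+ (c ℤ.- a) ℤ.* 1ℤ ≡ c
        identity₂ = solve-∀
        solution : (∃ λ u → v ℤ.* u ≈ 1ℤ) → ∃ λ i → a ℤ.+ i ℤ.* v ≈ c
        solution (u , vu≈1) = (c ℤ.- a) ℤ.* u , (begin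
          a ℤ.+ (c ℤ.- a) ℤ.* u ℤ.* v       ≡⟨ identity₁ a c u v ⟩
          a ℤ.+ (c ℤ.- a) ℤ.* (v ℤ.* u)     ≈⟨ +-cong (≈-refl {a}) (*-cong (≈-refl {c ℤ.- a}) vu≈1) ⟩
          a ℤ.+ (c ℤ.- a) ℤ.* 1ℤ            ≡⟨ identity₂ a c ⟩
          c                                 ∎)
          where open SetoidReasoning ≈-setoid

  opaque
    affine-const : ∀ a {v} → v ≈ 0ℤ → ∀ i j → a ℤ.+ i ℤ.* v ≈ a ℤ.+ j ℤ.* v
    affine-const a {v} v≈0 i j = ≈-trans (≈a i) (≈-sym (≈a j))
      where
      open SetoidReasoning ≈-setoid
      identity : ∀ a i → a ℤ.+ i ℤ.* 0ℤ ≡ a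
      identity = solve-∀
      ≈a : ∀ i → a ℤ.+ i ℤ.* v ≈ a
      ≈a i = begin
        a ℤ.+ i ℤ.* v    ≈⟨ +-cong (≈-refl {a}) (*-cong (≈-refl {i}) v≈0) ⟩
        a ℤ.+ i ℤ.* 0ℤ   ≡⟨ identity a i ⟩
        a                ∎

-- The point set

module Construction
  (n q r : ℕ) (n≡2q : n ≡ 2 * q) (p-prime : Prime (ℕ.suc n))
  (α β : Fin r → ℤ)
  (βα≈1 : ∀ j → Residues._≈_ n (β j ℤ.* α j) 1ℤ)
  (β-injective : ∀ {i j} → Residues._≈_ n (β i) (β j) → i ≡ j)
  where

  open Residues n

  private
    p = ℕ.suc n

  Point : Set
  Point = Fin p × Fin p × Fin p

  ⟪_,_,_⟫ : ℤ → ℤ → ℤ → Point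
  ⟪ x , y , z ⟫ = residue x , residue y , residue z

  -- Together these are all of 1, ..., p - 1, paired so that `even k` is `odd k` plus 1. This 1 is
  -- the rise of z = b x between x = 0 and x = 1/b.
  odd even : Fin q → ℤ
  odd  k = + ℕ.suc (2 * toℕ k)
  even k = + ℕ.suc (ℕ.suc (2 * toℕ k))

  -- β enumerates the planes y = b in which z = 0 is replaced by z = b x.
  Row : Fin p → Set
  Row y = ∃ λ j → ⟦ y ⟧ ≈ β j

  row? : ∀ y → Dec (Row y)
  row? y = Fin.any? λ j → ⟦ y ⟧ ≈? β j

  opaque
    -- The one height left out above (x, y) when x and y are nonzero. In a row y = b the line z = b
    -- x reads z = x y.
    surface : Fin p → Fin p → Fin p
    surface x y = if does (row? y) then residue (⟦ x ⟧ ℤ.* ⟦ y ⟧) else zero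

    surface-row : ∀ x y → Row y → surface x y ≡ residue (⟦ x ⟧ ℤ.* ⟦ y ⟧)
    surface-row x y row with row? y
    ... | yes _   = refl
    ... | no ¬row = contradiction row ¬row

    surface-¬row : ∀ x y → ¬ Row y → surface x y ≡ zero
    surface-¬row x y ¬row with row? y
    ... | yes row = contradiction row ¬row
    ... | no _    = refl

  private
    triples : ∀ k → List (Fin k × Fin k × Fin k)
    triples k = cartesianProduct (allFin k) (cartesianProduct (allFin k) (allFin k))

    triples-unique : ∀ k → Unique (triples k)
    triples-unique k = Unique.cartesianProduct⁺ (Unique.allFin⁺ k)
      (Unique.cartesianProduct⁺ (Unique.allFin⁺ k) (Unique.allFin⁺ k))

    length-pairs : ∀ k l → length (cartesianProduct (allFin k) (allFin l)) ≡ k * l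
    length-pairs k l = trans (length-cartesianProduct (allFin k) (allFin l))
      (cong₂ _*_ (length-allFin k) (length-allFin l))

    length-triples : ∀ k → length (triples k) ≡ k * (k * k)
    length-triples k = trans (length-cartesianProduct (allFin k) (cartesianProduct (allFin k) (allFin k)))
      (cong₂ _*_ (length-allFin k) (length-pairs k k))

  opaque
    -- Further points to leave out, with `α j` = 1 / `β j`: the rq points (1/b, b, t + 1) paid for
    -- the walls, the r² points (1/c, b, 0) kept on the old lines z = 0, and the r³ points put back
    -- at x = (b - b′)/(bc), where c, b, b′ are `β i`, `β k`, `β j`. Repetitions only make the count
    -- more generous.
    exceptional : List Point
    exceptional =
      map (λ (j , k) → ⟪ α j , β j , even k ⟫) (cartesianProduct (allFin r) (allFin q)) ++
      map (λ (i , j) → ⟪ α i , β j , 0ℤ ⟫) (cartesianProduct (allFin r) (allFin r)) ++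
      map (λ (i , k , j) → ⟪ α i ℤ.* (β k ℤ.- β j) ℤ.* α k , β j , 0ℤ ⟫) (triples r)

    ∈-exceptional₁ : ∀ j k → ⟪ α j , β j , even k ⟫ ∈ exceptional
    ∈-exceptional₁ j k = ∈-++⁺ˡ (∈-map⁺ _ (∈-cartesianProduct⁺ (∈-allFin j) (∈-allFin k)))

    ∈-exceptional₂ : ∀ i j → ⟪ α i , β j , 0ℤ ⟫ ∈ exceptional
    ∈-exceptional₂ i j = ∈-++⁺ʳ (map _ (cartesianProduct (allFin r) (allFin q)))
      (∈-++⁺ˡ (∈-map⁺ _ (∈-cartesianProduct⁺ (∈-allFin i) (∈-allFin j))))

    ∈-exceptional₃ : ∀ i k j → ⟪ α i ℤ.* (β k ℤ.- β j) ℤ.* α k , β j , 0ℤ ⟫ ∈ exceptional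
    ∈-exceptional₃ i k j = ∈-++⁺ʳ (map _ (cartesianProduct (allFin r) (allFin q)))
      (∈-++⁺ʳ (map _ (cartesianProduct (allFin r) (allFin r)))
        (∈-map⁺ _ (∈-cartesianProduct⁺ (∈-allFin i) (∈-cartesianProduct⁺ (∈-allFin k) (∈-allFin j)))))

    length-exceptional : length exceptional ≡ r * q + (r * r + r * (r * r))
    length-exceptional = trans
      (length-++ (map _ (cartesianProduct (allFin r) (allFin q))))
      (cong₂ _+_ (trans (length-map _ (cartesianProduct (allFin r) (allFin q))) (length-pairs r q)) (trans
        (length-++ (map _ (cartesianProduct (allFin r) (allFin r))))
        (cong₂ _+_ (trans (length-map _ (cartesianProduct (allFin r) (allFin r))) (length-pairs r r))
          (trans (length-map _ (triples r)) (length-triples r)))))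

  _≟_ : DecidableEquality Point
  _≟_ = Product.≡-dec Fin._≟_ (Product.≡-dec Fin._≟_ Fin._≟_)

  open import Data.List.Membership.DecPropositional _≟_ using (_∈?_)

  opaque
    -- `punchIn` runs through the p - 1 heights other than that of `surface`, so `generic` has (p -
    -- 1)³ points, all off the planes x = 0 and y = 0. The walls are the points gained on these two
    -- planes.
    wallˣ wallʸ generic interior avoiding : List Point
    wallˣ = map (λ (j , k) → ⟪ 0ℤ , β j , odd k ⟫) (cartesianProduct (allFin r) (allFin q))
    wallʸ = map (λ (j , k) → ⟪ α j , 0ℤ , even k ⟫) (cartesianProduct (allFin r) (allFin q))
    generic = map (λ (x , y , z) → suc x , suc y , punchIn (surface (suc x) (suc y)) z) (triples n)
    interior = filter (λ t → ¬? (t ∈? exceptional)) generic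
    avoiding = wallˣ ++ wallʸ ++ interior

  -- Heights and reciprocals modulo p

  2k+2≤n : ∀ (k : Fin q) → ℕ.suc (ℕ.suc (2 * toℕ k)) ≤ n
  2k+2≤n k = begin
    ℕ.suc (ℕ.suc (2 * toℕ k)) ≡⟨ ℕ.*-suc 2 (toℕ k) ⟨
    2 * ℕ.suc (toℕ k)         ≤⟨ ℕ.*-monoʳ-≤ 2 (Fin.toℕ<n k) ⟩
    2 * q                     ≡⟨ n≡2q ⟨
    n                         ∎
    where open ℕ.≤-Reasoning

  even<p : ∀ k → ℕ.suc (ℕ.suc (2 * toℕ k)) ℕ.< p
  even<p k = ℕ.s≤s (2k+2≤n k)

  odd<p : ∀ (k : Fin q) → ℕ.suc (2 * toℕ k) ℕ.< p
  odd<p k = ℕ.m≤n⇒m≤1+n (2k+2≤n k)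

  odd≉0 : ∀ k → odd k ≉ 0ℤ
  odd≉0 k e with () ← ≈⇒≡ (odd<p k) ℕ.z<s e

  even≉0 : ∀ k → even k ≉ 0ℤ
  even≉0 k e with () ← ≈⇒≡ (even<p k) ℕ.z<s e

  -- Both numbers lie below p, so a congruence would be an equality of integers of different parity.
  odd≉even : ∀ k l → odd k ≉ even l
  odd≉even k l e = ℕ.even≢odd (toℕ k) (toℕ l) (ℕ.suc-injective (≈⇒≡ (odd<p k) (even<p l) e))

  odd-injective : ∀ {k l} → odd k ≈ odd l → k ≡ l
  odd-injective {k} {l} e = Fin.toℕ-injective (ℕ.*-cancelˡ-≡ (toℕ k) (toℕ l) 2
    (ℕ.suc-injective (≈⇒≡ (odd<p k) (odd<p l) e)))

  even-injective : ∀ {k l} → even k ≈ even l → k ≡ l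
  even-injective {k} {l} e = Fin.toℕ-injective (ℕ.*-cancelˡ-≡ (toℕ k) (toℕ l) 2
    (ℕ.suc-injective (ℕ.suc-injective (≈⇒≡ (even<p k) (even<p l) e))))

  1≉0 : 1ℤ ≉ 0ℤ
  1≉0 e = contradiction
    (≈⇒≡ (ℕ.nonTrivial⇒n>1 p {{prime⇒nonTrivial p-prime}}) ℕ.z<s e) λ ()

  α≉0 : ∀ {j} → α j ≉ 0ℤ
  α≉0 {j} e = 1≉0 (≈-trans (≈-sym (βα≈1 j))
    (≈-trans (*-cong (≈-refl {β j}) e) (≈-reflexive (ℤ.*-zeroʳ (β j)))))

  β≉0 : ∀ {j} → β j ≉ 0ℤ
  β≉0 {j} e = 1≉0 (≈-trans (≈-sym (βα≈1 j))
    (≈-trans (*-cong e (≈-refl {α j})) (≈-reflexive (ℤ.*-zeroˡ (α j)))))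

  α-injective : ∀ {i j} → α i ≈ α j → i ≡ j
  α-injective {i} {j} e = β-injective (begin
    β i                       ≡⟨ ℤ.*-identityʳ (β i) ⟨
    β i ℤ.* 1ℤ                ≈⟨ *-cong (≈-refl {β i}) (βα≈1 j) ⟨
    β i ℤ.* (β j ℤ.* α j)     ≈⟨ *-cong (≈-refl {β i}) (*-cong (≈-refl {β j}) e) ⟨
    β i ℤ.* (β j ℤ.* α i)     ≡⟨ identity (β i) (β j) (α i) ⟩
    β j ℤ.* (β i ℤ.* α i)     ≈⟨ *-cong (≈-refl {β j}) (βα≈1 i) ⟩
    β j ℤ.* 1ℤ                ≡⟨ ℤ.*-identityʳ (β j) ⟩
    β j                       ∎)
    where
    open SetoidReasoning ≈-setoid
    identity : ∀ a b c → a ℤ.* (b ℤ.* c) ≡ b ℤ.* (a ℤ.* c)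
    identity = solve-∀

  -- Membership in the set, and its size

  Onˣ Onʸ Off : Point → Set
  Onˣ (x , y , z) = ⟦ x ⟧ ≈ 0ℤ × (∃₂ λ j k → ⟦ y ⟧ ≈ β j × ⟦ z ⟧ ≈ odd k)
  Onʸ (x , y , z) = ⟦ y ⟧ ≈ 0ℤ × (∃₂ λ j k → ⟦ x ⟧ ≈ α j × ⟦ z ⟧ ≈ even k)
  Off t@(x , y , z) = ⟦ x ⟧ ≉ 0ℤ × ⟦ y ⟧ ≉ 0ℤ × z ≢ surface x y × t ∉ exceptional

  opaque
    unfolding avoiding

    ∈-wallˣ⁻ : ∀ {t} → t ∈ wallˣ → Onˣ t
    ∈-wallˣ⁻ t∈ with ∈-map⁻ _ t∈
    ... | (j , k) , _ , refl = ⟦residue⟧ _ , j , k , ⟦residue⟧ _ , ⟦residue⟧ _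

    ∈-wallʸ⁻ : ∀ {t} → t ∈ wallʸ → Onʸ t
    ∈-wallʸ⁻ t∈ with ∈-map⁻ _ t∈
    ... | (j , k) , _ , refl = ⟦residue⟧ _ , j , k , ⟦residue⟧ _ , ⟦residue⟧ _

    ∈-interior⁻ : ∀ {t} → t ∈ interior → Off t
    ∈-interior⁻ t∈ with ∈-filter⁻ (λ t → ¬? (t ∈? exceptional)) {xs = generic} t∈
    ... | t∈generic , t∉exceptional with ∈-map⁻ _ t∈generic
    ... | (x , y , z) , _ , refl =
      ⟦suc⟧≉0 , ⟦suc⟧≉0 , Fin.punchInᵢ≢i (surface (suc x) (suc y)) z , t∉exceptional

    ∈-avoiding⁻ : ∀ {t} → t ∈ avoiding → Onˣ t ⊎ Onʸ t ⊎ Off t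
    ∈-avoiding⁻ t∈ with ∈-++⁻ wallˣ t∈
    ... | inj₁ t∈wallˣ = inj₁ (∈-wallˣ⁻ t∈wallˣ)
    ... | inj₂ t∈rest with ∈-++⁻ wallʸ t∈rest
    ...   | inj₁ t∈wallʸ    = inj₂ (inj₁ (∈-wallʸ⁻ t∈wallʸ))
    ...   | inj₂ t∈interior = inj₂ (inj₂ (∈-interior⁻ t∈interior))

    -- Once x and y agree, both heights skip the same value of `surface`, and `punchIn` at a fixed
    -- value is injective.
    generic-injective : ∀ {s t : Fin n × Fin n × Fin n} →
      (let (x , y , z) = s ; (x′ , y′ , z′) = t) →
      (Point ∋ (suc x , suc y , punchIn (surface (suc x) (suc y)) z)) ≡
      (suc x′ , suc y′ , punchIn (surface (suc x′) (suc y′)) z′) → s ≡ t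
    generic-injective {x , y , z} {x′ , y′ , z′} e
      with refl ← Fin.suc-injective (cong proj₁ e) | refl ← Fin.suc-injective (cong (proj₁ ∘ proj₂) e)
      = cong (λ z → x , y , z) (Fin.punchIn-injective (surface (suc x) (suc y)) z z′ (cong (proj₂ ∘ proj₂) e))

    generic-unique : Unique generic
    generic-unique = Unique.map⁺ generic-injective
      (triples-unique n)

    avoiding-unique : Unique avoiding
    avoiding-unique = Unique.++⁺
      (Unique.map⁺ wallˣ-injective (Unique.cartesianProduct⁺ (Unique.allFin⁺ r) (Unique.allFin⁺ q)))
      (Unique.++⁺
        (Unique.map⁺ wallʸ-injective (Unique.cartesianProduct⁺ (Unique.allFin⁺ r) (Unique.allFin⁺ q)))
        (Unique.filter⁺ _ generic-unique)
        λ (t∈wallʸ , t∈interior) → proj₁ (proj₂ (∈-interior⁻ t∈interior)) (proj₁ (∈-wallʸ⁻ t∈wallʸ)))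
      λ (t∈wallˣ , t∈rest) → wallˣ-disjoint (∈-wallˣ⁻ t∈wallˣ) (∈-++⁻ wallʸ t∈rest)
      where
      wallˣ-injective : ∀ {s t : Fin r × Fin q} →
        ⟪ 0ℤ , β (proj₁ s) , odd (proj₂ s) ⟫ ≡ ⟪ 0ℤ , β (proj₁ t) , odd (proj₂ t) ⟫ → s ≡ t
      wallˣ-injective e = cong₂ _,_
        (β-injective (residue-injective (cong (proj₁ ∘ proj₂) e)))
        (odd-injective (residue-injective (cong (proj₂ ∘ proj₂) e)))
      wallʸ-injective : ∀ {s t : Fin r × Fin q} →
        ⟪ α (proj₁ s) , 0ℤ , even (proj₂ s) ⟫ ≡ ⟪ α (proj₁ t) , 0ℤ , even (proj₂ t) ⟫ → s ≡ t
      wallʸ-injective e = cong₂ _,_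
        (α-injective (residue-injective (cong proj₁ e)))
        (even-injective (residue-injective (cong (proj₂ ∘ proj₂) e)))
      wallˣ-disjoint : ∀ {t} → Onˣ t → ¬ (t ∈ wallʸ ⊎ t ∈ interior)
      wallˣ-disjoint (x≈0 , _) (inj₁ t∈wallʸ) with ∈-wallʸ⁻ t∈wallʸ
      ... | _ , _ , _ , x≈α , _ = α≉0 (≈-trans (≈-sym x≈α) x≈0)
      wallˣ-disjoint (x≈0 , _) (inj₂ t∈interior) = proj₁ (∈-interior⁻ t∈interior) x≈0

    -- Every generic point is interior or exceptional, so at most rq + r² + r³ of the n³ generic
    -- points are lost. The two walls bring 2rq, of which rq pays for the first exceptional family.
    length-avoiding : n * (n * n) + r * q ≤ length avoiding + (r * r + r * (r * r))
    length-avoiding = begin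
      n * (n * n) + r * q                                              ≡⟨ cong (_+ r * q) (length-triples n) ⟨
      length (triples n) + r * q                                       ≡⟨ cong (_+ r * q) (length-map _ (triples n)) ⟨
      length generic + r * q                                           ≤⟨ ℕ.+-monoˡ-≤ (r * q) (length-mono-⊆ generic-unique generic-⊆) ⟩
      length (interior ++ exceptional) + r * q                         ≡⟨ cong (_+ r * q) (length-++ interior) ⟩
      length interior + length exceptional + r * q                     ≡⟨ cong (λ k → length interior + k + r * q) length-exceptional ⟩
      length interior + (r * q + (r * r + r * (r * r))) + r * q        ≡⟨ rearrange (length interior) (r * q) (r * r + r * (r * r)) ⟩
      r * q + (r * q + length interior) + (r * r + r * (r * r))        ≡⟨ cong (_+ (r * r + r * (r * r))) lengths ⟨
      length avoiding + (r * r + r * (r * r))                          ∎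
      where
      open ℕ.≤-Reasoning
      rearrange : ∀ i a b → i + (a + b) + a ≡ a + (a + i) + b
      rearrange = ℕ-Solver.solve-∀
      length-wall : ∀ f → length (map {B = Point} f (cartesianProduct (allFin r) (allFin q))) ≡ r * q
      length-wall f = trans (length-map f (cartesianProduct (allFin r) (allFin q))) (length-pairs r q)
      lengths : length avoiding ≡ r * q + (r * q + length interior)
      lengths = trans (length-++ wallˣ)
        (cong₂ _+_ (length-wall _) (trans (length-++ wallʸ) (cong (_+ length interior) (length-wall _))))
      generic-⊆ : generic ⊆ interior ++ exceptional
      generic-⊆ {t} t∈generic with t ∈? exceptional
      ... | yes t∈exceptional = ∈-++⁺ʳ interior t∈exceptional
      ... | no  t∉exceptional = ∈-++⁺ˡ (∈-filter⁺ (λ t → ¬? (t ∈? exceptional)) t∈generic t∉exceptional)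

  -- Consequences of membership for integer coordinates

  module _ {x y z : ℤ} (t∈ : ⟪ x , y , z ⟫ ∈ avoiding) where

    private
      to : ∀ {w c} → ⟦ residue w ⟧ ≈ c → w ≈ c
      to {w} e = ≈-trans (≈-sym (⟦residue⟧ w)) e

      from : ∀ {w c} → w ≈ c → ⟦ residue w ⟧ ≈ c
      from {w} e = ≈-trans (⟦residue⟧ w) e

    opaque
      avoiding-x≈0 : x ≈ 0ℤ → ∃₂ λ j k → y ≈ β j × z ≈ odd k
      avoiding-x≈0 x≈0 with ∈-avoiding⁻ t∈
      ... | inj₁ (_ , j , k , y≈β , z≈odd)       = j , k , to y≈β , to z≈odd
      ... | inj₂ (inj₁ (_ , _ , _ , x≈α , _))    = contradiction (≈-trans (≈-sym (to x≈α)) x≈0) α≉0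
      ... | inj₂ (inj₂ (x≉0 , _))                = contradiction (from x≈0) x≉0

      avoiding-y≈0 : y ≈ 0ℤ → ∃₂ λ j k → x ≈ α j × z ≈ even k
      avoiding-y≈0 y≈0 with ∈-avoiding⁻ t∈
      ... | inj₁ (_ , _ , _ , y≈β , _)           = contradiction (≈-trans (≈-sym (to y≈β)) y≈0) β≉0
      ... | inj₂ (inj₁ (_ , j , k , x≈α , z≈even)) = j , k , to x≈α , to z≈even
      ... | inj₂ (inj₂ (_ , y≉0 , _))            = contradiction (from y≈0) y≉0

      avoiding-off : x ≉ 0ℤ → y ≉ 0ℤ → Off ⟪ x , y , z ⟫
      avoiding-off x≉0 y≉0 with ∈-avoiding⁻ t∈
      ... | inj₁ (x≈0 , _)        = contradiction (to x≈0) x≉0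
      ... | inj₂ (inj₁ (y≈0 , _)) = contradiction (to y≈0) y≉0
      ... | inj₂ (inj₂ off)       = off

      avoiding-row : x ≉ 0ℤ → ∀ {j} → y ≈ β j → z ≉ x ℤ.* β j
      avoiding-row x≉0 {j} y≈β z≈xβ = proj₁ (proj₂ (proj₂ off))
        (trans (residue-cong z≈) (sym (surface-row (residue x) (residue y) (j , from y≈β))))
        where
        off : Off ⟪ x , y , z ⟫
        off = avoiding-off x≉0 (λ y≈0 → β≉0 {j} (≈-trans (≈-sym y≈β) y≈0))
        z≈ : z ≈ ⟦ residue x ⟧ ℤ.* ⟦ residue y ⟧
        z≈ = ≈-trans z≈xβ
          (*-cong (≈-sym (⟦residue⟧ x)) (≈-sym (from y≈β)))

      -- Outside the rows `surface` is 0, so height 0 is the one left out there.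
      avoiding-z≈0 : x ≉ 0ℤ → y ≉ 0ℤ → z ≈ 0ℤ → ∃ λ j → y ≈ β j
      avoiding-z≈0 x≉0 y≉0 z≈0 with avoiding-off x≉0 y≉0 | row? (residue y)
      ... | _ , _ , _ , _         | yes (j , y≈β) = j , to y≈β
      ... | _ , _ , z≢surface , _ | no ¬row       = contradiction
        (trans (⟦⟧-injective (from z≈0)) (sym (surface-¬row (residue x) (residue y) ¬row))) z≢surface

      avoiding-exceptional : x ≉ 0ℤ → y ≉ 0ℤ → ∀ {x′ y′ z′} → x ≈ x′ → y ≈ y′ → z ≈ z′ →
        ⟪ x′ , y′ , z′ ⟫ ∉ exceptional
      avoiding-exceptional x≉0 y≉0 x≈ y≈ z≈ t′∈ = proj₂ (proj₂ (proj₂ (avoiding-off x≉0 y≉0)))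
        (subst (_∈ exceptional)
          (sym (cong₂ _,_ (residue-cong x≈) (cong₂ _,_ (residue-cong y≈) (residue-cong z≈)))) t′∈)

  -- Lines inside the set, by the coordinates that vary

  module _ (a₁ v₁ a₂ v₂ a₃ v₃ : ℤ) where

    private
      x y z : ℤ → ℤ
      x i = a₁ ℤ.+ i ℤ.* v₁
      y i = a₂ ℤ.+ i ℤ.* v₂
      z i = a₃ ℤ.+ i ℤ.* v₃

    module _ (line : ∀ i → ⟪ x i , y i , z i ⟫ ∈ avoiding) where

      private
        at : ∀ a {v} → v ≉ 0ℤ → ∀ c → ∃ λ i → a ℤ.+ i ℤ.* v ≈ c
        at = affine-solve p-prime

        opaque
          x≈0⇒z≉0 : ∀ i → x i ≈ 0ℤ → z i ≉ 0ℤ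
          x≈0⇒z≉0 i x≈0 z≈0 with avoiding-x≈0 (line i) x≈0
          ... | _ , k , _ , z≈odd = odd≉0 k (≈-trans (≈-sym z≈odd) z≈0)

          y≈0⇒z≉0 : ∀ i → y i ≈ 0ℤ → z i ≉ 0ℤ
          y≈0⇒z≉0 i y≈0 z≈0 with avoiding-y≈0 (line i) y≈0
          ... | _ , k , _ , z≈even = even≉0 k (≈-trans (≈-sym z≈even) z≈0)

          -- Wall points have nonzero height, so where z vanishes the line is off both walls.
          z≈0⇒row : ∀ i → z i ≈ 0ℤ → ∃ λ j → y i ≈ β j
          z≈0⇒row i z≈0 = avoiding-z≈0 (line i) (λ e → x≈0⇒z≉0 i e z≈0) (λ e → y≈0⇒z≉0 i e z≈0) z≈0

        ≉-resp : ∀ {a b c} → a ≈ b → b ≉ c → a ≉ c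
        ≉-resp a≈b b≉c a≈c = b≉c (≈-trans (≈-sym a≈b) a≈c)

      -- Were z to vary, the line would reach height 0, which puts it in a row y = b with x nonzero.
      -- It would then also reach the height b x left out there.
      vertical : v₁ ≈ 0ℤ → v₂ ≈ 0ℤ → v₃ ≈ 0ℤ
      vertical v₁≈0 v₂≈0 with v₃ ≈? 0ℤ
      ... | yes v₃≈0 = v₃≈0
      ... | no  v₃≉0 with at a₃ v₃≉0 0ℤ
      ...   | i , zᵢ≈0 with z≈0⇒row i zᵢ≈0
      ...     | j , yᵢ≈β with at a₃ v₃≉0 (x i ℤ.* β j)
      ...       | l , zₗ≈xᵢβ = contradiction
        (≈-trans zₗ≈xᵢβ (*-cong (affine-const a₁ v₁≈0 i l) ≈-refl))
        (avoiding-row (line l) xₗ≉0 (≈-trans (affine-const a₂ v₂≈0 l i) yᵢ≈β))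
        where
        xₗ≉0 : x l ≉ 0ℤ
        xₗ≉0 xₗ≈0 = x≈0⇒z≉0 i
          (≈-trans (affine-const a₁ v₁≈0 i l) xₗ≈0) zᵢ≈0

      -- Were y to vary with x fixed, the line would cross y = 0 on the wall, so x = 1/c. If z is
      -- constant, its value is `even k` and the line meets the row y = c in an exceptional point of
      -- the first family. If z varies, the line reaches height 0 in some row y = b, at the point
      -- (1/c, b, 0) of the second family.
      column : v₁ ≈ 0ℤ → v₂ ≈ 0ℤ
      column v₁≈0 with v₂ ≈? 0ℤ
      ... | yes v₂≈0 = v₂≈0
      ... | no  v₂≉0 with at a₂ v₂≉0 0ℤ
      ...   | i , yᵢ≈0 with avoiding-y≈0 (line i) yᵢ≈0 | v₃ ≈? 0ℤ
      ...     | j , k , xᵢ≈α , zᵢ≈even | yes v₃≈0 =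
        let l , yₗ≈β = at a₂ v₂≉0 (β j)
            xₗ≈α = ≈-trans (affine-const a₁ v₁≈0 l i) xᵢ≈α
            zₗ≈even = ≈-trans (affine-const a₃ v₃≈0 l i) zᵢ≈even
        in contradiction (∈-exceptional₁ j k)
          (avoiding-exceptional (line l) (≉-resp xₗ≈α α≉0) (≉-resp yₗ≈β β≉0) xₗ≈α yₗ≈β zₗ≈even)
      ...     | i′ , _ , xᵢ≈α , _ | no v₃≉0 =
        let l , zₗ≈0 = at a₃ v₃≉0 0ℤ
            xₗ≈α = ≈-trans (affine-const a₁ v₁≈0 l i) xᵢ≈α
            j , yₗ≈β = z≈0⇒row l zₗ≈0
        in contradiction (∈-exceptional₂ i′ j)
          (avoiding-exceptional (line l) (≉-resp xₗ≈α α≉0) (≉-resp yₗ≈β β≉0) xₗ≈α yₗ≈β zₗ≈0)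

      -- In the plane y = β, the coordinate z - β x is affine along the line with
      -- slope w. If w vanishes, the line is parallel to z = β x, and it passes
      -- from height `odd k` at x = 0 to height `odd k + 1` at x = α.
      row : v₂ ≈ 0ℤ → v₁ ≈ 0ℤ
      row v₂≈0 with v₁ ≈? 0ℤ
      ... | yes v₁≈0 = v₁≈0
      ... | no  v₁≉0 with at a₁ v₁≉0 0ℤ
      ...   | i , xᵢ≈0 with avoiding-x≈0 (line i) xᵢ≈0
      ...     | j , k , yᵢ≈β , zᵢ≈odd with (v₃ ℤ.- β j ℤ.* v₁) ≈? 0ℤ
      ...       | yes w≈0 =
        let l , xₗ≈α = at a₁ v₁≉0 (α j)
            yₗ≈β = ≈-trans (affine-const a₂ v₂≈0 l i) yᵢ≈β
            zₗ≈even : z l ≈ even k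
            zₗ≈even = begin
              z l                                                        ≡⟨ identity a₁ v₁ a₃ v₃ (β j) i l ⟩
              z i ℤ.+ β j ℤ.* (x l ℤ.- x i) ℤ.+ (l ℤ.- i) ℤ.* w          ≈⟨ +-cong
                (+-cong zᵢ≈odd (*-cong (≈-refl {β j}) (minus-cong xₗ≈α xᵢ≈0)))
                (*-cong (≈-refl {l ℤ.- i}) w≈0) ⟩
              odd k ℤ.+ β j ℤ.* (α j ℤ.- 0ℤ) ℤ.+ (l ℤ.- i) ℤ.* 0ℤ        ≡⟨ simplify (odd k) (β j) (α j) (l ℤ.- i) ⟩
              β j ℤ.* α j ℤ.+ odd k                                      ≈⟨ +-cong (βα≈1 j) (≈-refl {odd k}) ⟩
              1ℤ ℤ.+ odd k                                               ∎
        in contradiction (∈-exceptional₁ j k)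
          (avoiding-exceptional (line l) (≉-resp xₗ≈α α≉0) (≉-resp yₗ≈β β≉0) xₗ≈α yₗ≈β zₗ≈even)
        where
        open SetoidReasoning ≈-setoid
        w = v₃ ℤ.- β j ℤ.* v₁
        identity : ∀ a₁ v₁ a₃ v₃ b i l → a₃ ℤ.+ l ℤ.* v₃ ≡
          (a₃ ℤ.+ i ℤ.* v₃) ℤ.+ b ℤ.* ((a₁ ℤ.+ l ℤ.* v₁) ℤ.- (a₁ ℤ.+ i ℤ.* v₁)) ℤ.+ (l ℤ.- i) ℤ.* (v₃ ℤ.- b ℤ.* v₁)
        identity = solve-∀
        simplify : ∀ o b a d → o ℤ.+ b ℤ.* (a ℤ.- 0ℤ) ℤ.+ d ℤ.* 0ℤ ≡ b ℤ.* a ℤ.+ o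
        simplify = solve-∀
      -- Now z - β x takes the value 0, so the line meets z = β x. This happens at nonzero x,
      -- because z would vanish with x.
      ...       | no w≉0 =
        let l , zₗ-βxₗ≈0 = at (a₃ ℤ.- β j ℤ.* a₁) w≉0 0ℤ
            yₗ≈β = ≈-trans (affine-const a₂ v₂≈0 l i) yᵢ≈β
            zₗ≈xₗβ : z l ≈ x l ℤ.* β j
            zₗ≈xₗβ = begin
              z l                                                                      ≡⟨ identity a₁ v₁ a₃ v₃ (β j) l ⟩
              x l ℤ.* β j ℤ.+ (a₃ ℤ.- β j ℤ.* a₁ ℤ.+ l ℤ.* (v₃ ℤ.- β j ℤ.* v₁))      ≈⟨ +-cong (≈-refl {x l ℤ.* β j}) zₗ-βxₗ≈0 ⟩
              x l ℤ.* β j ℤ.+ 0ℤ                                                       ≡⟨ ℤ.+-identityʳ (x l ℤ.* β j) ⟩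
              x l ℤ.* β j                                                              ∎
            xₗ≉0 : x l ≉ 0ℤ
            xₗ≉0 = λ xₗ≈0 → x≈0⇒z≉0 l xₗ≈0
              (≈-trans zₗ≈xₗβ
                (≈-trans (*-cong xₗ≈0 ≈-refl) (≈-reflexive (ℤ.*-zeroˡ (β j)))))
        in contradiction zₗ≈xₗβ (avoiding-row (line l) xₗ≉0 yₗ≈β)
        where
        open SetoidReasoning ≈-setoid
        identity : ∀ a₁ v₁ a₃ v₃ b l → a₃ ℤ.+ l ℤ.* v₃ ≡
          (a₁ ℤ.+ l ℤ.* v₁) ℤ.* b ℤ.+ (a₃ ℤ.- b ℤ.* a₁ ℤ.+ l ℤ.* (v₃ ℤ.- b ℤ.* v₁))
        identity = solve-∀

      -- The line crosses x = 0 at an odd height and y = 0 at an even one. Hence z is not constant,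
      -- and the point at height 0 lies in a row; it belongs to the third exceptional family.
      diagonal : ¬ (v₁ ≉ 0ℤ × v₂ ≉ 0ℤ)
      diagonal (v₁≉0 , v₂≉0) with at a₁ v₁≉0 0ℤ | at a₂ v₂≉0 0ℤ
      ... | i , xᵢ≈0 | l , yₗ≈0 with avoiding-x≈0 (line i) xᵢ≈0 | avoiding-y≈0 (line l) yₗ≈0 | v₃ ≈? 0ℤ
      ...   | _ , k , _ , zᵢ≈odd | _ , k′ , _ , zₗ≈even | yes v₃≈0 = odd≉even k k′
        (≈-trans (≈-sym zᵢ≈odd) (≈-trans (affine-const a₃ v₃≈0 i l) zₗ≈even))
      ...   | k , _ , yᵢ≈β , _ | i′ , _ , xₗ≈α , _ | no v₃≉0 =
        let m , zₘ≈0 = at a₃ v₃≉0 0ℤ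
            j , yₘ≈β = z≈0⇒row m zₘ≈0
            -- Projected to the xy-plane, the line joins (0, `β k`) to (`α i′`, 0). Collinearity
            -- gives x `β k` = `α i′` (`β k` - `β j`) at y = `β j`, and multiplying by `α k`
            -- isolates x.
            xₘ≈ : x m ≈ α i′ ℤ.* (β k ℤ.- β j) ℤ.* α k
            xₘ≈ = begin
              x m                                             ≡⟨ ℤ.*-identityʳ (x m) ⟨
              x m ℤ.* 1ℤ                                      ≈⟨ *-cong (≈-refl {x m}) (βα≈1 k) ⟨
              x m ℤ.* (β k ℤ.* α k)                           ≡⟨ simplify (x m) (β k) (α k) ⟩
              (x m ℤ.- 0ℤ) ℤ.* (β k ℤ.- 0ℤ) ℤ.* α k           ≈⟨ *-cong
                (*-cong (minus-cong (≈-refl {x m}) xᵢ≈0) (minus-cong yᵢ≈β yₗ≈0)) ≈-refl ⟨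
              (x m ℤ.- x i) ℤ.* (y i ℤ.- y l) ℤ.* α k         ≡⟨ cong (ℤ._* α k) (identity a₁ v₁ a₂ v₂ i l m) ⟩
              (x l ℤ.- x i) ℤ.* (y i ℤ.- y m) ℤ.* α k         ≈⟨ *-cong
                (*-cong (minus-cong xₗ≈α xᵢ≈0) (minus-cong yᵢ≈β yₘ≈β)) ≈-refl ⟩
              (α i′ ℤ.- 0ℤ) ℤ.* (β k ℤ.- β j) ℤ.* α k         ≡⟨ cong (λ a → a ℤ.* (β k ℤ.- β j) ℤ.* α k) (ℤ.+-identityʳ (α i′)) ⟩
              α i′ ℤ.* (β k ℤ.- β j) ℤ.* α k                  ∎
        in avoiding-exceptional (line m) (λ e → x≈0⇒z≉0 m e zₘ≈0) (λ e → y≈0⇒z≉0 m e zₘ≈0) xₘ≈ yₘ≈β zₘ≈0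
          (∈-exceptional₃ i′ k j)
        where
        open SetoidReasoning ≈-setoid
        simplify : ∀ x b a → x ℤ.* (b ℤ.* a) ≡ (x ℤ.- 0ℤ) ℤ.* (b ℤ.- 0ℤ) ℤ.* a
        simplify = solve-∀
        identity : ∀ a₁ v₁ a₂ v₂ i l m →
          ((a₁ ℤ.+ m ℤ.* v₁) ℤ.- (a₁ ℤ.+ i ℤ.* v₁)) ℤ.* ((a₂ ℤ.+ i ℤ.* v₂) ℤ.- (a₂ ℤ.+ l ℤ.* v₂)) ≡
          ((a₁ ℤ.+ l ℤ.* v₁) ℤ.- (a₁ ℤ.+ i ℤ.* v₁)) ℤ.* ((a₂ ℤ.+ i ℤ.* v₂) ℤ.- (a₂ ℤ.+ m ℤ.* v₂))
        identity = solve-∀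

      line-constant : v₁ ≈ 0ℤ × v₂ ≈ 0ℤ × v₃ ≈ 0ℤ
      line-constant with v₁ ≈? 0ℤ | v₂ ≈? 0ℤ
      ... | yes v₁≈0 | _        = v₁≈0 , column v₁≈0 , vertical v₁≈0 (column v₁≈0)
      ... | _        | yes v₂≈0 = row v₂≈0 , v₂≈0 , vertical (row v₂≈0) v₂≈0
      ... | no v₁≉0  | no v₂≉0  = contradiction (v₁≉0 , v₂≉0) diagonal

  -- From lines to progressions

  toVect : Point → Vect p 3
  toVect (x , y , z) = x Vector.∷ y Vector.∷ z Vector.∷ Vector.[]

  toVect-injective : ∀ {s t} → toVect s ≡ toVect t → s ≡ t
  toVect-injective e = cong₂ _,_ (cong-app e zero)
    (cong₂ _,_ (cong-app e (suc zero)) (cong-app e (suc (suc zero))))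

  -- A progression with p terms is a whole line: its index runs through all residues, so every
  -- integer parameter i is represented.
  ⟦apPoint⟧ : ∀ (a v : Vect p 3) i j →
    ⟦ apPoint p 3 a (toℕ (residue i)) v j ⟧ ≈ ⟦ a j ⟧ ℤ.+ i ℤ.* ⟦ v j ⟧
  ⟦apPoint⟧ a v i j = begin
    ⟦ apPoint p 3 a k v j ⟧                               ≈⟨ ⟦mod⟧ _ ⟩
    ⟦ a j ⟧ ℤ.+ ⟦ nmulF p k (v j) ⟧                       ≈⟨ +-cong (≈-refl {⟦ a j ⟧}) (⟦mod⟧ (k * toℕ (v j))) ⟩
    ⟦ a j ⟧ ℤ.+ + (k * toℕ (v j))                         ≡⟨ cong (ℤ._+_ ⟦ a j ⟧) (ℤ.pos-* k (toℕ (v j))) ⟩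
    ⟦ a j ⟧ ℤ.+ + k ℤ.* ⟦ v j ⟧                           ≈⟨ +-cong (≈-refl {⟦ a j ⟧}) (*-cong (⟦residue⟧ i) (≈-refl {⟦ v j ⟧})) ⟩
    ⟦ a j ⟧ ℤ.+ i ℤ.* ⟦ v j ⟧                             ∎
    where
    open SetoidReasoning ≈-setoid
    k = toℕ (residue i)

  avoiding-APFree : APFree p p 3 (map toVect avoiding)
  avoiding-APFree = Unique.map⁺ toVect-injective avoiding-unique , noAP
    where
    noAP : ¬ ContainsAP p p 3 (map toVect avoiding)
    noAP (a , v , v≢0 , points) = v≢0 λ where
        zero             → toZero (proj₁ constant)
        (suc zero)       → toZero (proj₁ (proj₂ constant))
        (suc (suc zero)) → toZero (proj₂ (proj₂ constant))
      where
      coordinate : ℤ → Fin 3 → ℤ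
      coordinate i j = ⟦ a j ⟧ ℤ.+ i ℤ.* ⟦ v j ⟧
      line : ∀ i → ⟪ coordinate i zero , coordinate i (suc zero) , coordinate i (suc (suc zero)) ⟫ ∈ avoiding
      line i with ∈-map⁻ toVect (points (residue i))
      ... | t , t∈ , e = subst (_∈ avoiding)
        (cong₂ _,_ (same zero) (cong₂ _,_ (same (suc zero)) (same (suc (suc zero))))) t∈
        where
        same : ∀ j → toVect t j ≡ residue (coordinate i j)
        same j = trans (sym (cong-app e j))
          (⟦⟧-injective (≈-trans (⟦apPoint⟧ a v i j) (≈-sym (⟦residue⟧ (coordinate i j)))))
      constant = line-constant ⟦ a zero ⟧ ⟦ v zero ⟧ ⟦ a (suc zero) ⟧ ⟦ v (suc zero) ⟧
        ⟦ a (suc (suc zero)) ⟧ ⟦ v (suc (suc zero)) ⟧ line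
      toZero : ∀ {x} → ⟦ x ⟧ ≈ 0ℤ → x ≡ zeroV p 3 zero
      toZero x≈0 = ⟦⟧-injective (≈-trans x≈0 (≈-sym (⟦mod⟧ 0)))

-- Choice of r and the numerical bound

-- This r is the integer part of √p / 2; passing from p to p + 1 raises it by at most one.
half-√ : ∀ p → ∃ λ r → 4 * (r * r) ≤ p × p ℕ.< 4 * (ℕ.suc r * ℕ.suc r)
half-√ ℕ.zero = 0 , ℕ.z≤n , ℕ.z<s
half-√ (ℕ.suc p) with half-√ p
... | r , 4r²≤p , p<4[1+r]² with ℕ.suc p ℕ.<? 4 * (ℕ.suc r * ℕ.suc r)
...   | yes 1+p<4[1+r]² = r , ℕ.m≤n⇒m≤1+n 4r²≤p , 1+p<4[1+r]²
...   | no  1+p≮4[1+r]² = ℕ.suc r , ℕ.≮⇒≥ 1+p≮4[1+r]² , ℕ.≤-<-trans p<4[1+r]²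
  (ℕ.*-monoʳ-< 4 (ℕ.*-mono-< (ℕ.n<1+n (ℕ.suc r)) (ℕ.n<1+n (ℕ.suc r))))

odd-prime : ∀ {n} → Prime (ℕ.suc n) → 3 ≤ ℕ.suc n → ∃ λ q → n ≡ 2 * q
odd-prime {n} p-prime 3≤p with n % 2 | n / 2 | m≡m%n+[m/n]*n n 2 | m%n<n n 2
... | 0 | q | n≡q*2 | _ = q , trans n≡q*2 (ℕ.*-comm q 2)
-- Here p = n + 1 would be even, and a prime divisible by 2 is 2.
... | 1 | q | n≡1+q*2 | _ = contradiction
  (prime⇒irreducible p-prime (ℕ.divides (ℕ.suc q) (cong ℕ.suc n≡1+q*2)))
  λ { (inj₁ ()) ; (inj₂ 2≡p) → ℕ.<⇒≢ 3≤p 2≡p }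
... | ℕ.suc (ℕ.suc _) | _ | _ | ℕ.s≤s (ℕ.s≤s ())

-- The factor 16 clears denominators, and 4p(r + 1) stands in for 16 · p^(3/2) / 8, which it exceeds
-- since 2(r + 1) > √p. The loss 16(r² + r³) = 4(r + 1) · 4r² is at most 4(r + 1)p, against a gain
-- of 16rq = 8rn.
cubic-bound : ∀ L n q r → n ≡ 2 * q → 4 * (r * r) ≤ ℕ.suc n →
  n * (n * n) + r * q ≤ L + (r * r + r * (r * r)) →
  4 * (ℕ.suc n * ℕ.suc r) + 16 * ℕ.suc n ^ 3 ≤ 16 * L + 48 * ℕ.suc n ^ 2 + 7 * ℕ.suc n
cubic-bound L n@.(2 * q) q r refl 4r²≤p count = ℕ.+-cancelʳ-≤ (16 * (r * r + r * (r * r))) _ _ (begin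
  4 * (p * ℕ.suc r) + 16 * p ^ 3 + 16 * (r * r + r * (r * r))
    ≡⟨ reorder p r (16 * p ^ 3) ⟩
  4 * ℕ.suc r * (4 * (r * r)) + (16 * p ^ 3 + 4 * (p * ℕ.suc r))
    ≤⟨ ℕ.+-monoˡ-≤ (16 * p ^ 3 + 4 * (p * ℕ.suc r)) (ℕ.*-monoʳ-≤ (4 * ℕ.suc r) 4r²≤p) ⟩
  4 * ℕ.suc r * p + (16 * p ^ 3 + 4 * (p * ℕ.suc r))
    ≡⟨ collect n r (16 * p ^ 3) ⟩
  8 * r + (16 * p ^ 3 + 8 * r * n + 8 * p)
    ≤⟨ ℕ.+-monoˡ-≤ (16 * p ^ 3 + 8 * r * n + 8 * p) (ℕ.*-monoʳ-≤ 8 r≤p) ⟩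
  8 * p + (16 * p ^ 3 + 8 * r * n + 8 * p)
    -- The slack is 39p - 16: on the right 16n³ + 48p² is 16p³ + 48p - 16, a further 7p is allowed,
    -- and 16p is spent on the left.
    ≤⟨ ℕ.m≤m+n _ (39 * n + 23) ⟩
  8 * p + (16 * p ^ 3 + 8 * r * n + 8 * p) + (39 * n + 23)
    ≡⟨ expand q r ⟩
  16 * (n * (n * n) + r * q) + (48 * p ^ 2 + 7 * p)
    ≤⟨ ℕ.+-monoˡ-≤ (48 * p ^ 2 + 7 * p) (ℕ.*-monoʳ-≤ 16 count) ⟩
  16 * (L + (r * r + r * (r * r))) + (48 * p ^ 2 + 7 * p)
    ≡⟨ rearrange L (r * r + r * (r * r)) (48 * p ^ 2) (7 * p) ⟩
  16 * L + 48 * p ^ 2 + 7 * p + 16 * (r * r + r * (r * r)) ∎)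
  where
  open ℕ.≤-Reasoning
  p = ℕ.suc n
  r≤p : r ≤ p
  r≤p = ℕ.≤-trans (m≤m*m r) (ℕ.≤-trans (ℕ.m≤n*m (r * r) 4) 4r²≤p)
    where
    m≤m*m : ∀ m → m ≤ m * m
    m≤m*m ℕ.zero    = ℕ.z≤n
    m≤m*m (ℕ.suc m) = ℕ.m≤m*n (ℕ.suc m) (ℕ.suc m)
  reorder : ∀ p r c → 4 * (p * (1 + r)) + c + 16 * (r * r + r * (r * r)) ≡
    4 * (1 + r) * (4 * (r * r)) + (c + 4 * (p * (1 + r)))
  reorder = ℕ-Solver.solve-∀
  collect : ∀ n r c → 4 * (1 + r) * (1 + n) + (c + 4 * ((1 + n) * (1 + r))) ≡
    8 * r + (c + 8 * r * n + 8 * (1 + n))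
  collect = ℕ-Solver.solve-∀
  expand : ∀ q r → let n = 2 * q; p = 1 + n in
    8 * p + (16 * (p * (p * (p * 1))) + 8 * r * n + 8 * p) + (39 * n + 23) ≡
    16 * (n * (n * n) + r * q) + (48 * (p * (p * 1)) + 7 * p)
  expand = ℕ-Solver.solve-∀
  rearrange : ∀ L c a b → 16 * (L + c) + (a + b) ≡ 16 * L + a + b + 16 * c
  rearrange = ℕ-Solver.solve-∀

-- This is X ≥ 2 p^(3/2) without the root: 16p²(r + 1)² is 4p² times 4(r + 1)², and the second
-- factor exceeds p.
square-bound : ∀ {p r X} → p ℕ.< 4 * (ℕ.suc r * ℕ.suc r) → 4 * (p * ℕ.suc r) ≤ X → 4 * p ^ 3 ≤ X ^ 2
square-bound {p} {r} {X} p<4[1+r]² bound = begin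
  4 * p ^ 3                                   ≡⟨ split p ⟩
  4 * (p * p) * p                             ≤⟨ ℕ.*-monoʳ-≤ (4 * (p * p)) (ℕ.<⇒≤ p<4[1+r]²) ⟩
  4 * (p * p) * (4 * (ℕ.suc r * ℕ.suc r))     ≡⟨ regroup p r ⟩
  (4 * (p * ℕ.suc r)) ^ 2                     ≤⟨ ℕ.^-monoˡ-≤ 2 bound ⟩
  X ^ 2                                       ∎
  where
  open ℕ.≤-Reasoning
  split : ∀ p → 4 * (p * (p * (p * 1))) ≡ 4 * (p * p) * p
  split = ℕ-Solver.solve-∀
  regroup : ∀ p r → 4 * (p * p) * (4 * ((1 + r) * (1 + r))) ≡
    4 * (p * (1 + r)) * (4 * (p * (1 + r)) * 1)
  regroup = ℕ-Solver.solve-∀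

theorem1p3 : (p : ℕ) .{{_ : NonZero p}} → Prime p → 3 ≤ p →
    Σ (List (Vect p 3)) λ S → APFree p p 3 S ×
    ((16 * p ^ 3 ≤ 16 * length S + 48 * p ^ 2 + 7 * p) ×
    (4 * p ^ 3 ≤ (16 * length S + 48 * p ^ 2 + 7 * p ∸ 16 * p ^ 3) ^ 2))
theorem1p3 (ℕ.suc n) p-prime 3≤p with odd-prime p-prime 3≤p | half-√ (ℕ.suc n)
... | q , n≡2q | r , 4r²≤p , p<4[1+r]² =
  map toVect avoiding , avoiding-APFree ,
  -- This component makes the truncated subtraction in the next one an honest difference.
  ℕ.m+n≤o⇒n≤o (4 * (p * ℕ.suc r)) bound ,
  square-bound p<4[1+r]² (ℕ.m+n≤o⇒m≤o∸n (4 * (p * ℕ.suc r)) bound)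
  where
  p = ℕ.suc n
  open Residues n

  -- An element of `Fin r` forces r ≥ 1, and then r + 1 ≤ 4r² ≤ p. The inequality r + 1 ≤ 4r² fails
  -- at r = 0, the value for p = 3.
  r<p : Fin r → r ℕ.< p
  r<p j = ℕ.≤-trans (1+m≤4m² j) 4r²≤p
    where
    identity : ∀ m → 4 * ((1 + m) * (1 + m)) ≡ 2 + m + (2 + 7 * m + 4 * (m * m))
    identity = ℕ-Solver.solve-∀
    1+m≤4m² : ∀ {m} → Fin m → ℕ.suc m ≤ 4 * (m * m)
    1+m≤4m² {ℕ.suc m} _ = subst (2 + m ≤_) (sym (identity m)) (ℕ.m≤m+n (2 + m) _)

  -- The values b are 1, ..., r, which are distinct and nonzero modulo p because r < p.
  β : Fin r → ℤ
  β j = + ℕ.suc (toℕ j)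

  β<p : ∀ j → ℕ.suc (toℕ j) ℕ.< p
  β<p j = ℕ.≤-<-trans (Fin.toℕ<n j) (r<p j)

  reciprocal : ∀ j → ∃ λ u → β j ℤ.* u ≈ 1ℤ
  reciprocal j = inverse p-prime λ β≈0 → contradiction (≈⇒≡ (β<p j) ℕ.z<s β≈0) λ ()

  β-injective : ∀ {i j} → β i ≈ β j → i ≡ j
  β-injective {i} {j} e = Fin.toℕ-injective (ℕ.suc-injective (≈⇒≡ (β<p i) (β<p j) e))

  open Construction n q r n≡2q p-prime (proj₁ ∘ reciprocal) β (proj₂ ∘ reciprocal) β-injective

  bound : 4 * (p * ℕ.suc r) + 16 * p ^ 3 ≤ 16 * length (map toVect avoiding) + 48 * p ^ 2 + 7 * p
  bound = cubic-bound (length (map toVect avoiding)) n q r n≡2q 4r²≤p (subst (λ L → n * (n * n) + r * q ≤ L + (r * r + r * (r * r)))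
    (sym (length-map toVect avoiding)) length-avoiding)
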